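{- An $\mathcal{L}(\Box)$-formula is equivalent to an $\mathcal{L}(\circ)$-formula if and only if it is invariant under $\circ$-bisimulation. That is, for every $\phi\in\mathcal{L}(\Box)$: there is $\psi\in\mathcal{L}(\circ)$ such that for all pointed models $(\mathcal{M},s)$, $\mathcal{M},s\vDash\phi$ iff $\mathcal{M},s\vDash\psi$, if and only if for all pointed models $(\mathcal{M},s)$ and $(\mathcal{N},t)$ that are $\circ$-bisimilar, $\mathcal{M},s\vDash\phi$ iff $\mathcal{N},t\vDash\phi$.
   Context: Let $\mathbf{P}$ be a set of propositional variables. The language $\mathcal{L}(\circ)$ is given by $\phi::=p\mid\neg\phi\mid(\phi\land\phi)\mid\circ\phi$ and the language $\mathcal{L}(\Box)$ by $\phi::=p\mid\neg\phi\mid(\phi\land\phi)\mid\Box\phi$, with $p\in\mathbf{P}$. A model is $\mathcal{M}=\langle S,R,V\rangle$ with $S$ a nonempty set, $R\subseteq S\times S$, and $V:\mathbf{P}\to\mathcal{P}(S)$; a pointed model $(\mathcal{M},s)$ is a model with a designated $s\in S$. Satisfaction: $\mathcal{M},s\vDash p$ iff $s\in V(p)$; Booleans as usual; $\mathcal{M},s\vDash\Box\phi$ iff $\mathcal{M},t\vDash\phi$ for all $t$ with $sRt$; $\mathcal{M},s\vDash\circ\phi$ iff ($\mathcal{M},s\vDash\phi$ implies that $\mathcal{M},t\vDash\phi$ for all $t$ with $sRt$). A nonempty binary relation $Z$ over $S$ is a $\circ$-bisimulation on $\mathcal{M}=\langle S,R,V\rangle$ if $sZs'$ implies: (Inv)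 for all $p\in\mathbf{P}$, $s\in V(p)$ iff $s'\in V(p)$; ($\circ$-Forth) if $sRt$ and $(s,t)\notin Z$, then there is $t'$ with $s'Rt'$ and $tZt'$; ($\circ$-Back) if $s'Rt'$ and $(s',t')\notin Z$, then there is $t$ with $sRt$ and $tZt'$. Pointed models $(\mathcal{M},s)$ and $(\mathcal{M}',s')$ are $\circ$-bisimilar if there is a $\circ$-bisimulation $Z$ on the disjoint union of $\mathcal{M}$ and $\mathcal{M}'$ with $sZs'$. -}

module Defs where

open import Data.Product.Base using (_×_; _,_; ∃-syntax; ∃₂)
open import Data.Sum.Base using (_⊎_; inj₁; inj₂; [_,_]′)
open import Data.Sum.Relation.Binary.Pointwise using (Pointwise)
open import Function.Bundles using (_⇔_)
open import Level using (Level; _⊔_; suc)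
open import Relation.Binary.Core using (Rel)
open import Relation.Nullary.Negation.Core using (¬_)
open import Relation.Unary using (Pred)

private
  variable
    a ℓ : Level
    P : Set a

-- Object-language negation is ~_, to keep ¬_ for the metalanguage.
infix  10 `_
infix  9 ~_ □_ ∘_
infixr 8 _∧_

data 𝓛□ (P : Set a) : Set a where
  `_  : P → 𝓛□ P
  ~_  : 𝓛□ P → 𝓛□ P
  _∧_ : 𝓛□ P → 𝓛□ P → 𝓛□ P
  □_  : 𝓛□ P → 𝓛□ P

data 𝓛∘ (P : Set a) : Set a where
  `_  : P → 𝓛∘ P
  ~_  : 𝓛∘ P → 𝓛∘ P
  _∧_ : 𝓛∘ P → 𝓛∘ P → 𝓛∘ P
  ∘_  : 𝓛∘ P → 𝓛∘ P

record Model (P : Set a) (ℓ : Level) : Set (a ⊔ suc ℓ) where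
  field
    S        : Set ℓ
    nonempty : S
    R        : Rel S ℓ
    V        : P → Pred S ℓ

record PointedModel (P : Set a) (ℓ : Level) : Set (a ⊔ suc ℓ) where
  constructor _at_
  field
    model : Model P ℓ
  open Model model public
  field
    point : S

infix 4 _⊨□_ _⊨∘_

_⊨□_ : PointedModel P ℓ → 𝓛□ P → Set ℓ
(M at s) ⊨□ (` p)   = Model.V M p s
(M at s) ⊨□ (~ φ)   = ¬ ((M at s) ⊨□ φ)
(M at s) ⊨□ (φ ∧ ψ) = ((M at s) ⊨□ φ) × ((M at s) ⊨□ ψ)
(M at s) ⊨□ (□ φ)   = ∀ t → Model.R M s t → (M at t) ⊨□ φ

_⊨∘_ : PointedModel P ℓ → 𝓛∘ P → Set ℓ
(M at s) ⊨∘ (` p)   = Model.V M p s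
(M at s) ⊨∘ (~ φ)   = ¬ ((M at s) ⊨∘ φ)
(M at s) ⊨∘ (φ ∧ ψ) = ((M at s) ⊨∘ φ) × ((M at s) ⊨∘ ψ)
(M at s) ⊨∘ (∘ φ)   = (M at s) ⊨∘ φ → ∀ t → Model.R M s t → (M at t) ⊨∘ φ

record Is∘-Bisimulation {P : Set a} (M : Model P ℓ)
                        (Z : Rel (Model.S M) ℓ) : Set (a ⊔ ℓ) where
  open Model M
  field
    inhabited : ∃₂ Z
    inv       : ∀ {s s′} → Z s s′ → ∀ p → V p s ⇔ V p s′
    forth     : ∀ {s s′} → Z s s′ → ∀ {t} → R s t → ¬ Z s t →
                ∃[ t′ ] (R s′ t′ × Z t t′)
    back      : ∀ {s s′} → Z s s′ → ∀ {t′} → R s′ t′ → ¬ Z s′ t′ →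
                ∃[ t ] (R s t × Z t t′)

infixr 6 _⊎ᴹ_

_⊎ᴹ_ : Model P ℓ → Model P ℓ → Model P ℓ
M ⊎ᴹ N = record
  { S        = M.S ⊎ N.S
  ; nonempty = inj₁ M.nonempty
  ; R        = Pointwise M.R N.R
  ; V        = λ p → [ M.V p , N.V p ]′
  }
  where
  module M = Model M
  module N = Model N

∘-Bisimilar : PointedModel P ℓ → PointedModel P ℓ → Set _
∘-Bisimilar (M at s) (N at t) =
  ∃[ Z ] (Is∘-Bisimulation (M ⊎ᴹ N) Z × Z (inj₁ s) (inj₂ t))

{-# OPTIONS --safe #-}

-- Any step to a Z-related state is exempt from the back and forth conditions, so
-- a model is ∘-bisimilar to its reflexive closure.  On reflexive models □ φ is
-- equivalent to φ ∧ ∘ φ, so an invariant φ is equivalent, over all models, to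
-- the ∘-formula obtained by rewriting every □ in this way.
module Submission where

open import Defs
open import Axiom.ExcludedMiddle using (ExcludedMiddle)
open import Data.Product.Base using (_×_; _,_; ∃-syntax)
open import Data.Product.Function.NonDependent.Propositional using (_×-⇔_)
open import Data.Sum.Base using (inj₁; inj₂; reduce)
open import Data.Sum.Relation.Binary.Pointwise using (inj₁; inj₂)
open import Function.Bundles using (_⇔_; mk⇔; module Equivalence)
open import Function.Properties.Equivalence using (⇔-isEquivalence)
open import Function.Related.TypeIsomorphisms using (¬-cong-⇔)
open import Level using (Level; _⊔_)
open import Relation.Binary.Construct.Closure.Reflexive using (ReflClosure; [_]; refl)
open import Relation.Binary.Core using (Rel)
open import Relation.Binary.Definitions using (Reflexive)
open import Relation.Binary.PropositionalEquality.Core as ≡ using (_≡_)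
open import Relation.Binary.Structures using (module IsEquivalence)
open import Relation.Nullary.Decidable.Core using (yes; no)
open import Relation.Nullary.Negation.Core using (¬_; contradiction)

open Equivalence using (to; from)
open module ⇔ {ℓ} = IsEquivalence (⇔-isEquivalence {ℓ}) using ()
  renaming (refl to ⇔-refl; sym to ⇔-sym; trans to ⇔-trans)

private
  variable
    a ℓ : Level
    P : Set a

-- Needed for the two injections into a disjoint union: a ∘-bisimulation lives on the union, so
-- truth has to be carried from each component into it.
record IsBoundedMorphism {P : Set a} (M N : Model P ℓ)
                         (f : Model.S M → Model.S N) : Set (a ⊔ ℓ) where
  private
    module M = Model M
    module N = Model N
  field
    inv   : ∀ p s → M.V p s ⇔ N.V p (f s)
    forth : ∀ {s t} → M.R s t → N.R (f s) (f t)
    back  : ∀ {s u} → N.R (f s) u → ∃[ t ] (M.R s t × f t ≡ u)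

module _ {M N : Model P ℓ} {f : Model.S M → Model.S N}
         (bounded : IsBoundedMorphism M N f) where
  open IsBoundedMorphism bounded

  ⊨∘-boundedMorphism : ∀ ψ s → ((M at s) ⊨∘ ψ) ⇔ ((N at f s) ⊨∘ ψ)
  ⊨∘-boundedMorphism (` p)   s = inv p s
  ⊨∘-boundedMorphism (~ ψ)   s = ¬-cong-⇔ (⊨∘-boundedMorphism ψ s)
  ⊨∘-boundedMorphism (ψ ∧ χ) s = ⊨∘-boundedMorphism ψ s ×-⇔ ⊨∘-boundedMorphism χ s
  ⊨∘-boundedMorphism (∘ ψ)   s = mk⇔ forward backward
    where
    forward : (M at s) ⊨∘ (∘ ψ) → (N at f s) ⊨∘ (∘ ψ)
    forward h fs⊨ψ u r with back r
    ... | t , s→t , ≡.refl =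
      to (⊨∘-boundedMorphism ψ t) (h (from (⊨∘-boundedMorphism ψ s) fs⊨ψ) t s→t)

    backward : (N at f s) ⊨∘ (∘ ψ) → (M at s) ⊨∘ (∘ ψ)
    backward h s⊨ψ t s→t =
      from (⊨∘-boundedMorphism ψ t) (h (to (⊨∘-boundedMorphism ψ s) s⊨ψ) (f t) (forth s→t))

module _ (M N : Model P ℓ) where

  inj₁-boundedMorphism : IsBoundedMorphism M (M ⊎ᴹ N) inj₁
  inj₁-boundedMorphism = record
    { inv   = λ _ _ → ⇔-refl
    ; forth = inj₁
    ; back  = λ { (inj₁ r) → _ , r , ≡.refl }
    }

  inj₂-boundedMorphism : IsBoundedMorphism N (M ⊎ᴹ N) inj₂
  inj₂-boundedMorphism = record
    { inv   = λ _ _ → ⇔-refl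
    ; forth = inj₂
    ; back  = λ { (inj₂ r) → _ , r , ≡.refl }
    }

module _ (em : ExcludedMiddle ℓ) {M : Model P ℓ} {Z : Rel (Model.S M) ℓ}
         (bisim : Is∘-Bisimulation M Z) where
  open Is∘-Bisimulation bisim

  -- Induction on `ψ`. For `∘ ψ`, excluded middle decides whether a successor is `Z`-related to its
  -- source. An unrelated successor is matched by `back` or `forth`.
  ⊨∘-bisimulation : ∀ ψ {s s′} → Z s s′ → ((M at s) ⊨∘ ψ) ⇔ ((M at s′) ⊨∘ ψ)
  ⊨∘-bisimulation (` p)   z = inv z p
  ⊨∘-bisimulation (~ ψ)   z = ¬-cong-⇔ (⊨∘-bisimulation ψ z)
  ⊨∘-bisimulation (ψ ∧ χ) z = ⊨∘-bisimulation ψ z ×-⇔ ⊨∘-bisimulation χ z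
  ⊨∘-bisimulation (∘ ψ) {s} {s′} z = mk⇔ forward backward
    where
    forward : (M at s) ⊨∘ (∘ ψ) → (M at s′) ⊨∘ (∘ ψ)
    forward h s′⊨ψ t′ r′ with em {Z s′ t′}
    -- No matching step is available here, but none is required: the induction hypothesis along `z′`
    -- carries `ψ` from `s′` to its own successor `t′`.
    ... | yes z′ = to (⊨∘-bisimulation ψ z′) s′⊨ψ
    ... | no ¬z′ with back z r′ ¬z′
    ...   | t , r , zt = to (⊨∘-bisimulation ψ zt) (h (from (⊨∘-bisimulation ψ z) s′⊨ψ) t r)

    backward : (M at s′) ⊨∘ (∘ ψ) → (M at s) ⊨∘ (∘ ψ)
    backward h s⊨ψ t r with em {Z s t}
    ... | yes z′ = to (⊨∘-bisimulation ψ z′) s⊨ψ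
    ... | no ¬z′ with forth z r ¬z′
    ...   | t′ , r′ , zt = from (⊨∘-bisimulation ψ zt) (h (to (⊨∘-bisimulation ψ z) s⊨ψ) t′ r′)

⊨∘-invariant : ExcludedMiddle ℓ → (ψ : 𝓛∘ P) (M N : PointedModel P ℓ) →
               ∘-Bisimilar M N → (M ⊨∘ ψ) ⇔ (N ⊨∘ ψ)
⊨∘-invariant em ψ (M at s) (N at t) (Z , bisim , z) =
  ⇔-trans (⊨∘-boundedMorphism (inj₁-boundedMorphism M N) ψ s)
  (⇔-trans (⊨∘-bisimulation em bisim ψ z)
  (⇔-sym (⊨∘-boundedMorphism (inj₂-boundedMorphism M N) ψ t)))

reflexive : Model P ℓ → Model P ℓ
reflexive M = record { Model M ; R = ReflClosure (Model.R M) }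

reflexive-∘-bisimilar : (M : Model P ℓ) (s : Model.S M) →
                        ∘-Bisimilar (M at s) (reflexive M at s)
reflexive-∘-bisimilar M s = Z , bisim , ≡.refl
  where
  U = M ⊎ᴹ reflexive M
  open Model U using (S; R; V)

  Z : Rel S _
  -- The kernel of `reduce` rather than just the pairing of the two copies: it also relates each
  -- state to itself, which exempts the added loops.
  Z x y = reduce x ≡ reduce y

  inv : ∀ {x y} → Z x y → ∀ p → V p x ⇔ V p y
  inv {inj₁ _} {inj₁ _} ≡.refl p = ⇔-refl
  inv {inj₁ _} {inj₂ _} ≡.refl p = ⇔-refl
  inv {inj₂ _} {inj₁ _} ≡.refl p = ⇔-refl
  inv {inj₂ _} {inj₂ _} ≡.refl p = ⇔-refl

  -- The only steps absent from `M` are the added loops, and these join `Z`-related states.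
  step : ∀ {x y} → R x y → ¬ Z x y → Model.R M (reduce x) (reduce y)
  step (inj₁ r)     _  = r
  step (inj₂ [ r ]) _  = r
  step (inj₂ refl)  ¬z = contradiction ≡.refl ¬z

  -- Supplies the answering step in `forth`: the reflexive closure contains the original relation,
  -- so a step of `M` can be replayed in either copy.
  lift : ∀ x {t} → Model.R M (reduce x) t → ∃[ y ] (R x y × reduce y ≡ t)
  lift (inj₁ _) r = inj₁ _ , inj₁ r , ≡.refl
  lift (inj₂ _) r = inj₂ _ , inj₂ [ r ] , ≡.refl

  forth : ∀ {x x′} → Z x x′ → ∀ {y} → R x y → ¬ Z x y → ∃[ y′ ] (R x′ y′ × Z y y′)
  forth {x′ = x′} z r ¬z
    with y′ , r′ , y′≡y ← lift x′ (≡.subst (λ u → Model.R M u _) z (step r ¬z))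
    = y′ , r′ , ≡.sym y′≡y

  bisim : Is∘-Bisimulation U Z
  bisim = record
    { inhabited = inj₁ s , inj₂ s , ≡.refl
    ; inv       = λ {x} {y} → inv {x} {y}
    ; forth     = λ {x} {x′} → forth {x} {x′}
    -- `Z` is symmetric, so this is `forth` with the two states exchanged.
    ; back      = λ {x} {x′} z r ¬z →
        let y , r′ , z′ = forth {x′} {x} (≡.sym z) r ¬z in y , r′ , ≡.sym z′
    }

translate : 𝓛□ P → 𝓛∘ P
translate (` p)   = ` p
translate (~ φ)   = ~ translate φ
translate (φ ∧ ψ) = translate φ ∧ translate ψ
translate (□ φ)   = translate φ ∧ ∘ translate φ

-- Reflexivity makes `□ φ` yield `φ` at `s` itself; that `φ ∧ ∘ φ` yields `□ φ` is true on every
-- model.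
⊨-translate : (M : Model P ℓ) → Reflexive (Model.R M) → ∀ φ s →
              ((M at s) ⊨□ φ) ⇔ ((M at s) ⊨∘ translate φ)
⊨-translate M rfl (` p)   s = ⇔-refl
⊨-translate M rfl (~ φ)   s = ¬-cong-⇔ (⊨-translate M rfl φ s)
⊨-translate M rfl (φ ∧ ψ) s = ⊨-translate M rfl φ s ×-⇔ ⊨-translate M rfl ψ s
⊨-translate M rfl (□ φ)   s = mk⇔
  (λ h → to (⊨-translate M rfl φ s) (h s rfl) , λ _ t r → to (⊨-translate M rfl φ t) (h t r))
  (λ (s⊨φ , h) t r → from (⊨-translate M rfl φ t) (h s⊨φ t r))

theorem28 : ∀ {a ℓ} → ExcludedMiddle ℓ → (P : Set a) (φ : 𝓛□ P) →
    (∃[ ψ ] (∀ (M : PointedModel P ℓ) → (M ⊨□ φ) ⇔ (M ⊨∘ ψ)))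
    ⇔
    (∀ (M N : PointedModel P ℓ) → ∘-Bisimilar M N → (M ⊨□ φ) ⇔ (N ⊨□ φ))
theorem28 em P φ = mk⇔
  (λ (ψ , φ⇔ψ) M N M∼N →
    ⇔-trans (φ⇔ψ M) (⇔-trans (⊨∘-invariant em ψ M N M∼N) (⇔-sym (φ⇔ψ N))))
  -- `M` may fail to be reflexive, so the comparison takes a detour: invariance of `φ` leads to
  -- `M′`, where `translate φ` agrees with `φ`, and invariance of ∘-formulas leads back.
  (λ invariant → translate φ , λ (M at s) →
    let M′  = reflexive M
        bis = reflexive-∘-bisimilar M s
    in ⇔-trans (invariant (M at s) (M′ at s) bis)
      (⇔-trans (⊨-translate M′ refl φ s)
      (⇔-sym (⊨∘-invariant em (translate φ) (M at s) (M′ at s) bis))))
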